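{- Let $P(x)=x^2+k_2$ be a real polynomial with $k_2\neq 0$. Then $P(x)$ is $\mathcal{R}$ if and only if $P(x)$ is $\mathcal{IR}$.
   Context: A monic real polynomial $P(x)$ of degree $n$ is realizable ($\mathcal{R}$) if it is the characteristic polynomial of some $n\times n$ entrywise nonnegative matrix; it is irreducibly realizable ($\mathcal{IR}$) if it is the characteristic polynomial of some $n\times n$ irreducible entrywise nonnegative matrix. A square matrix is irreducible if it is not similar by a permutation matrix to a nontrivially block triangular matrix (equivalently, its digraph is strongly connected). -}

module Defs where

open import Algebra.Bundles using (CommutativeRing; RawRing)
import Algebra.Definitions.RawSemiring as RawSemiringDefinitions
open import Data.Bool.Base using (if_then_else_)
open import Data.Fin.Base as Fin using (Fin; toℕ; punchIn)
import Data.Fin.Properties as Fin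
open import Data.Fin.Permutation using (Permutation′; _⟨$⟩ʳ_)
open import Data.List.Base as List using (List; []; _∷_)
open import Data.Nat.Base as ℕ using (ℕ; zero; suc)
import Data.Nat.Properties as ℕ
open import Data.Product.Base using (Σ; ∃; ∃-syntax; _×_; _,_)
open import Data.Rational.Base as ℚ using (ℚ; 0ℚ; 1ℚ; ½; ∣_∣)
import Data.Rational.Properties as ℚ
open import Data.Rational.Solver using (module +-*-Solver)
open import Level using (0ℓ)
open import Relation.Binary.PropositionalEquality
  using (_≡_; refl; sym; trans; cong; cong₂; subst; subst₂)
open import Relation.Nullary.Decidable.Core using (does)
open import Relation.Nullary.Negation.Core using (¬_)

module Polynomials {c ℓ} (R : RawRing c ℓ) where
  open RawRing R

  -- A list of coefficients, lowest degree first.  Trailing zeros are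
  -- allowed, so polynomials are compared by _≈ᵖ_.
  Poly : Set c
  Poly = List Carrier

  coeff : Poly → ℕ → Carrier
  coeff []      _       = 0#
  coeff (a ∷ p) zero    = a
  coeff (a ∷ p) (suc k) = coeff p k

  infix 4 _≈ᵖ_
  _≈ᵖ_ : Poly → Poly → Set ℓ
  p ≈ᵖ q = ∀ k → coeff p k ≈ coeff q k

  const : Carrier → Poly
  const a = a ∷ []

  X : Poly
  X = 0# ∷ 1# ∷ []

  infixl 6 _+ᵖ_
  _+ᵖ_ : Poly → Poly → Poly
  []      +ᵖ q       = q
  (a ∷ p) +ᵖ []      = a ∷ p
  (a ∷ p) +ᵖ (b ∷ q) = (a + b) ∷ (p +ᵖ q)

  infixl 7 _*ᵖ_
  _*ᵖ_ : Poly → Poly → Poly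
  []      *ᵖ q = []
  (a ∷ p) *ᵖ q = List.map (a *_) q +ᵖ (0# ∷ (p *ᵖ q))

  polynomialRing : RawRing c ℓ
  polynomialRing = record
    { Carrier = Poly
    ; _≈_     = _≈ᵖ_
    ; _+_     = _+ᵖ_
    ; _*_     = _*ᵖ_
    ; -_      = List.map -_
    ; 0#      = []
    ; 1#      = const 1#
    }

  open RawSemiringDefinitions (RawRing.rawSemiring polynomialRing) public
    using () renaming (_^_ to _^ᵖ_)

  IsMonicOfDegree : ℕ → Poly → Set ℓ
  IsMonicOfDegree n p =
    coeff p n ≈ 1# × (∀ k → n ℕ.< k → coeff p k ≈ 0#)

module Matrices {c ℓ} (R : RawRing c ℓ) where
  open RawRing R
  open RawSemiringDefinitions rawSemiring using (sum; _^_)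

  Matrix : ℕ → ℕ → Set c
  Matrix m n = Fin m → Fin n → Carrier

  infixl 7 _*ᴹ_
  _*ᴹ_ : ∀ {l m n} → Matrix l m → Matrix m n → Matrix l n
  (A *ᴹ B) i j = sum λ k → A i k * B k j

  infix 8 _ᵀ
  _ᵀ : ∀ {m n} → Matrix m n → Matrix n m
  (A ᵀ) i j = A j i

  -- Laplace expansion along the first row.
  det : ∀ {n} → Matrix n n → Carrier
  det {zero}  A = 1#
  det {suc n} A = sum λ j →
    (- 1#) ^ toℕ j * (A Fin.zero j * det λ i k → A (Fin.suc i) (punchIn j k))

  permutationMatrix : ∀ {n} → Permutation′ n → Matrix n n
  permutationMatrix σ i j = if does (σ ⟨$⟩ʳ i Fin.≟ j) then 1# else 0#

  -- Block upper triangular with diagonal blocks of sizes k and n - k,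
  -- both nonempty.
  NontriviallyBlockTriangular : ∀ {n} → Matrix n n → Set ℓ
  NontriviallyBlockTriangular {n} A = ∃[ k ] (0 ℕ.< k × k ℕ.< n ×
    (∀ i j → k ℕ.≤ toℕ i → toℕ j ℕ.< k → A i j ≈ 0#))

  -- P ᵀ is the inverse of the permutation matrix P, so P *ᴹ A *ᴹ P ᵀ is
  -- permutation similar to A.
  Irreducible : ∀ {n} → Matrix n n → Set ℓ
  Irreducible {n} A = ¬ (Σ (Permutation′ n) λ σ → let P = permutationMatrix σ in
    NontriviallyBlockTriangular (P *ᴹ A *ᴹ P ᵀ))

module CharacteristicPolynomial {c ℓ} (R : RawRing c ℓ) where
  open RawRing R
  open Polynomials R
  open Matrices R using (Matrix)
  open RawRing polynomialRing using () renaming (-_ to -ᵖ_; 0# to 0ᵖ)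

  charMatrix : ∀ {n} → Matrix n n → Matrices.Matrix polynomialRing n n
  charMatrix A i j =
    (if does (i Fin.≟ j) then X else 0ᵖ) +ᵖ (-ᵖ const (A i j))

  charPoly : ∀ {n} → Matrix n n → Poly
  charPoly A = Matrices.det polynomialRing (charMatrix A)

-- The reals are Cauchy sequences of rationals; their equality is _≈_ below,
-- not propositional equality.
IsCauchy : (ℕ → ℚ) → Set
IsCauchy x = ∀ ε → 0ℚ ℚ.< ε →
  ∃[ N ] (∀ m n → N ℕ.≤ m → N ℕ.≤ n → ∣ x m ℚ.- x n ∣ ℚ.< ε)

record ℝ : Set where
  constructor mkℝ
  field
    seq      : ℕ → ℚ
    isCauchy : IsCauchy seq

open ℝ public

-- Records rather than functions, so that x and y can be inferred from
-- x ≈ y and x ≤ y.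
infix 4 _≈_ _≤_

record _≈_ (x y : ℝ) : Set where
  constructor mk≈
  field
    close : ∀ ε → 0ℚ ℚ.< ε →
      ∃[ N ] (∀ n → N ℕ.≤ n → ∣ seq x n ℚ.- seq y n ∣ ℚ.< ε)

open _≈_ public

record _≤_ (x y : ℝ) : Set where
  constructor mk≤
  field
    below : ∀ ε → 0ℚ ℚ.< ε →
      ∃[ N ] (∀ n → N ℕ.≤ n → seq x n ℚ.< seq y n ℚ.+ ε)

open _≤_ public

≗⇒≈ : ∀ {x y} → (∀ n → seq x n ≡ seq y n) → x ≈ y
≗⇒≈ {x} {y} x≗y = mk≈ λ ε 0<ε → 0 , λ n _ →
  subst (λ q → ∣ q ∣ ℚ.< ε) (sym (diff≡0 n)) 0<ε
  where
  diff≡0 : ∀ n → seq x n ℚ.- seq y n ≡ 0ℚ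
  diff≡0 n = trans (cong (ℚ._- seq y n) (x≗y n)) (ℚ.+-inverseʳ (seq y n))

private
  open +-*-Solver using (solve; con; _:=_; _:+_; _:*_; _:-_; :-_)

  ½-pos : ∀ {ε} → 0ℚ ℚ.< ε → 0ℚ ℚ.< ½ ℚ.* ε
  ½-pos {ε} 0<ε = ℚ.*-monoʳ-<-pos ½ 0<ε

  ½+½ : ∀ ε → ½ ℚ.* ε ℚ.+ ½ ℚ.* ε ≡ ε
  ½+½ = solve 1 (λ e → con ½ :* e :+ con ½ :* e := e) refl

  sum-small : ∀ {ε} a b {s} → ∣ a ∣ ℚ.< ½ ℚ.* ε → ∣ b ∣ ℚ.< ½ ℚ.* ε →
              a ℚ.+ b ≡ s → ∣ s ∣ ℚ.< ε
  sum-small {ε} a b a< b< refl = ℚ.≤-<-trans (ℚ.∣p+q∣≤∣p∣+∣q∣ a b)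
    (subst (∣ a ∣ ℚ.+ ∣ b ∣ ℚ.<_) (½+½ ε) (ℚ.+-mono-< a< b<))

  difference-swap : ∀ p q → ∣ p ℚ.- q ∣ ≡ ∣ q ℚ.- p ∣
  difference-swap p q = trans (sym (ℚ.∣-p∣≡∣p∣ (p ℚ.- q)))
    (cong ∣_∣ (solve 2 (λ p q → :- (p :- q) := q :- p) refl p q))

  negate-difference : ∀ p q {ε} → ∣ p ℚ.- q ∣ ℚ.< ε →
                      ∣ (ℚ.- p) ℚ.- (ℚ.- q) ∣ ℚ.< ε
  negate-difference p q {ε} = subst (ℚ._< ε) (trans (difference-swap p q)
    (cong ∣_∣ (solve 2 (λ p q → q :- p := (:- p) :- (:- q)) refl p q)))

  +-difference : ∀ p q r s →
    (p ℚ.- r) ℚ.+ (q ℚ.- s) ≡ (p ℚ.+ q) ℚ.- (r ℚ.+ s)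
  +-difference = solve 4 (λ p q r s →
    (p :- r) :+ (q :- s) := (p :+ q) :- (r :+ s)) refl

  *-difference : ∀ p q r s →
    p ℚ.* (q ℚ.- s) ℚ.+ s ℚ.* (p ℚ.- r) ≡ p ℚ.* q ℚ.- r ℚ.* s
  *-difference = solve 4 (λ p q r s →
    p :* (q :- s) :+ s :* (p :- r) := p :* q :- r :* s) refl

  *-small : ∀ {B δ} p q → 0ℚ ℚ.< B → ∣ p ∣ ℚ.< B → ∣ q ∣ ℚ.< δ →
            ∣ p ℚ.* q ∣ ℚ.< B ℚ.* δ
  *-small {B} {δ} p q 0<B p<B q<δ =
    subst (ℚ._< B ℚ.* δ) (sym (ℚ.∣p*q∣≡∣p∣*∣q∣ p q))
      (ℚ.≤-<-trans
        (ℚ.*-monoʳ-≤-nonNeg ∣ q ∣ {{ℚ.∣-∣-nonNeg q}} (ℚ.<⇒≤ p<B))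
        (ℚ.*-monoʳ-<-pos B {{ℚ.positive 0<B}} q<δ))

  -- An eventual bound is enough for products.
  bounded : ∀ x → IsCauchy x →
            ∃[ B ] (0ℚ ℚ.< B × ∃[ N ] (∀ n → N ℕ.≤ n → ∣ x n ∣ ℚ.< B))
  bounded x cx with cx 1ℚ (ℚ.positive⁻¹ 1ℚ)
  ... | N , near = 1ℚ ℚ.+ ∣ x N ∣ , 0<B , N , bound
    where
    0<B : 0ℚ ℚ.< 1ℚ ℚ.+ ∣ x N ∣
    0<B = ℚ.+-mono-<-≤ (ℚ.positive⁻¹ 1ℚ) (ℚ.0≤∣p∣ (x N))
    bound : ∀ n → N ℕ.≤ n → ∣ x n ∣ ℚ.< 1ℚ ℚ.+ ∣ x N ∣
    bound n N≤n = subst (λ q → ∣ q ∣ ℚ.< 1ℚ ℚ.+ ∣ x N ∣)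
      (solve 2 (λ a b → (a :- b) :+ b := a) refl (x n) (x N))
      (ℚ.≤-<-trans (ℚ.∣p+q∣≤∣p∣+∣q∣ (x n ℚ.- x N) (x N))
        (ℚ.+-monoˡ-< ∣ x N ∣ (near n N N≤n ℕ.≤-refl)))

  scale : ∀ B → 0ℚ ℚ.< B → ∀ ε → 0ℚ ℚ.< ε →
          ∃[ δ ] (0ℚ ℚ.< δ × B ℚ.* δ ≡ ½ ℚ.* ε)
  scale B 0<B ε 0<ε = 1/B ℚ.* (½ ℚ.* ε) , 0<δ ,
    trans (sym (ℚ.*-assoc B 1/B _))
      (trans (cong (ℚ._* (½ ℚ.* ε)) (ℚ.*-inverseʳ B)) (ℚ.*-identityˡ _))
    where
    instance
      B-pos = ℚ.positive 0<B
      B-nonZero = ℚ.pos⇒nonZero B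
    1/B = ℚ.1/ B
    0<δ : 0ℚ ℚ.< 1/B ℚ.* (½ ℚ.* ε)
    0<δ = subst (ℚ._< 1/B ℚ.* (½ ℚ.* ε)) (ℚ.*-zeroʳ 1/B)
      (ℚ.*-monoʳ-<-pos 1/B {{ℚ.1/pos⇒pos B}} (½-pos 0<ε))

  product-small : ∀ {B C δ η ε} p q r s → 0ℚ ℚ.< B → 0ℚ ℚ.< C →
    ∣ p ∣ ℚ.< B → ∣ s ∣ ℚ.< C → B ℚ.* δ ≡ ½ ℚ.* ε → C ℚ.* η ≡ ½ ℚ.* ε →
    ∣ q ℚ.- s ∣ ℚ.< δ → ∣ p ℚ.- r ∣ ℚ.< η → ∣ p ℚ.* q ℚ.- r ℚ.* s ∣ ℚ.< ε
  product-small p q r s 0<B 0<C p<B s<C Bδ Cη q-s p-r =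
    sum-small (p ℚ.* (q ℚ.- s)) (s ℚ.* (p ℚ.- r))
      (subst (_ ℚ.<_) Bδ (*-small p (q ℚ.- s) 0<B p<B q-s))
      (subst (_ ℚ.<_) Cη (*-small s (p ℚ.- r) 0<C s<C p-r))
      (*-difference p q r s)

  ⊔-left : ∀ {k m n} → m ℕ.⊔ n ℕ.≤ k → m ℕ.≤ k
  ⊔-left {m = m} {n} = ℕ.≤-trans (ℕ.m≤m⊔n m n)

  ⊔-right : ∀ {k m n} → m ℕ.⊔ n ℕ.≤ k → n ℕ.≤ k
  ⊔-right {m = m} {n} = ℕ.≤-trans (ℕ.m≤n⊔m m n)

  +-isCauchy : ∀ x y → IsCauchy x → IsCauchy y →
               IsCauchy (λ n → x n ℚ.+ y n)
  +-isCauchy x y cx cy ε 0<ε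
    with cx (½ ℚ.* ε) (½-pos 0<ε) | cy (½ ℚ.* ε) (½-pos 0<ε)
  ... | M , f | N , g = M ℕ.⊔ N , λ m n l l′ →
    sum-small (x m ℚ.- x n) (y m ℚ.- y n)
      (f m n (⊔-left l) (⊔-left l′)) (g m n (⊔-right l) (⊔-right l′))
      (+-difference (x m) (y m) (x n) (y n))

  *-isCauchy : ∀ x y → IsCauchy x → IsCauchy y →
               IsCauchy (λ n → x n ℚ.* y n)
  *-isCauchy x y cx cy ε 0<ε =
    let B , 0<B , K , x<B = bounded x cx
        C , 0<C , L , y<C = bounded y cy
        δ , 0<δ , Bδ = scale B 0<B ε 0<ε
        η , 0<η , Cη = scale C 0<C ε 0<ε
        M , f = cy δ 0<δ
        N , g = cx η 0<η
    in (K ℕ.⊔ L) ℕ.⊔ (M ℕ.⊔ N) , λ m n l l′ →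
    product-small (x m) (y m) (x n) (y n) 0<B 0<C
      (x<B m (⊔-left {n = L} (⊔-left {n = M ℕ.⊔ N} l)))
      (y<C n (⊔-right {m = K} (⊔-left {n = M ℕ.⊔ N} l′)))
      Bδ Cη
      (f m n (⊔-left {n = N} (⊔-right {m = K ℕ.⊔ L} l))
             (⊔-left {n = N} (⊔-right {m = K ℕ.⊔ L} l′)))
      (g m n (⊔-right {m = M} (⊔-right {m = K ℕ.⊔ L} l))
             (⊔-right {m = M} (⊔-right {m = K ℕ.⊔ L} l′)))

fromℚ : ℚ → ℝ
fromℚ q = mkℝ (λ _ → q) λ ε 0<ε → 0 , λ _ _ _ _ →
  subst (λ p → ∣ p ∣ ℚ.< ε) (sym (ℚ.+-inverseʳ q)) 0<ε

0ℝ 1ℝ : ℝ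
0ℝ = fromℚ 0ℚ
1ℝ = fromℚ 1ℚ

infixl 6 _+_
infixl 7 _*_
infix  8 -_

_+_ _*_ : ℝ → ℝ → ℝ
x + y = mkℝ (λ n → seq x n ℚ.+ seq y n)
  (+-isCauchy (seq x) (seq y) (isCauchy x) (isCauchy y))
x * y = mkℝ (λ n → seq x n ℚ.* seq y n)
  (*-isCauchy (seq x) (seq y) (isCauchy x) (isCauchy y))

-_ : ℝ → ℝ
- x = mkℝ (λ n → ℚ.- seq x n) λ ε 0<ε → let N , f = isCauchy x ε 0<ε in
  N , λ m n l l′ → negate-difference (seq x m) (seq x n) (f m n l l′)

private
  ≈-trans : ∀ {x y z} → x ≈ y → y ≈ z → x ≈ z
  ≈-trans {x} {y} {z} x≈y y≈z = mk≈ go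
    where
    go : ∀ ε → 0ℚ ℚ.< ε →
         ∃[ N ] (∀ n → N ℕ.≤ n → ∣ seq x n ℚ.- seq z n ∣ ℚ.< ε)
    go ε 0<ε with close x≈y (½ ℚ.* ε) (½-pos 0<ε)
                | close y≈z (½ ℚ.* ε) (½-pos 0<ε)
    ... | M , f | N , g = M ℕ.⊔ N , λ n l →
      sum-small (seq x n ℚ.- seq y n) (seq y n ℚ.- seq z n)
        (f n (⊔-left l)) (g n (⊔-right l))
        (solve 3 (λ x y z → (x :- y) :+ (y :- z) := x :- z) refl
          (seq x n) (seq y n) (seq z n))

  ≈-sym : ∀ {x y} → x ≈ y → y ≈ x
  ≈-sym {x} {y} x≈y = mk≈ λ ε 0<ε → let N , f = close x≈y ε 0<ε in
    N , λ n l → subst (ℚ._< ε) (difference-swap (seq x n) (seq y n)) (f n l)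

  +-cong : ∀ {x y u v} → x ≈ y → u ≈ v → x + u ≈ y + v
  +-cong {x} {y} {u} {v} x≈y u≈v = mk≈ go
    where
    go : ∀ ε → 0ℚ ℚ.< ε →
         ∃[ N ] (∀ n → N ℕ.≤ n → ∣ seq (x + u) n ℚ.- seq (y + v) n ∣ ℚ.< ε)
    go ε 0<ε with close x≈y (½ ℚ.* ε) (½-pos 0<ε)
                | close u≈v (½ ℚ.* ε) (½-pos 0<ε)
    ... | M , f | N , g = M ℕ.⊔ N , λ n l →
      sum-small (seq x n ℚ.- seq y n) (seq u n ℚ.- seq v n)
        (f n (⊔-left l)) (g n (⊔-right l))
        (+-difference (seq x n) (seq u n) (seq y n) (seq v n))

  *-cong : ∀ {x y u v} → x ≈ y → u ≈ v → x * u ≈ y * v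
  *-cong {x} {y} {u} {v} x≈y u≈v = mk≈ go
    where
    go : ∀ ε → 0ℚ ℚ.< ε →
         ∃[ N ] (∀ n → N ℕ.≤ n → ∣ seq (x * u) n ℚ.- seq (y * v) n ∣ ℚ.< ε)
    go ε 0<ε =
      let B , 0<B , K , x<B = bounded (seq x) (isCauchy x)
          C , 0<C , L , v<C = bounded (seq v) (isCauchy v)
          δ , 0<δ , Bδ = scale B 0<B ε 0<ε
          η , 0<η , Cη = scale C 0<C ε 0<ε
          M , f = close u≈v δ 0<δ
          N , g = close x≈y η 0<η
      in (K ℕ.⊔ L) ℕ.⊔ (M ℕ.⊔ N) , λ n l →
      product-small (seq x n) (seq u n) (seq y n) (seq v n) 0<B 0<C
        (x<B n (⊔-left {n = L} (⊔-left {n = M ℕ.⊔ N} l)))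
        (v<C n (⊔-right {m = K} (⊔-left {n = M ℕ.⊔ N} l)))
        Bδ Cη
        (f n (⊔-left {n = N} (⊔-right {m = K ℕ.⊔ L} l)))
        (g n (⊔-right {m = M} (⊔-right {m = K ℕ.⊔ L} l)))

  -‿cong : ∀ {x y} → x ≈ y → - x ≈ - y
  -‿cong {x} {y} x≈y = mk≈ λ ε 0<ε → let N , f = close x≈y ε 0<ε in
    N , λ n l → negate-difference (seq x n) (seq y n) (f n l)

ℝ-commutativeRing : CommutativeRing 0ℓ 0ℓ
ℝ-commutativeRing = record
  { Carrier = ℝ
  ; _≈_ = _≈_
  ; _+_ = _+_
  ; _*_ = _*_
  ; -_  = -_
  ; 0#  = 0ℝ
  ; 1#  = 1ℝ
  ; isCommutativeRing = record
    { isRing = record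
      { +-isAbelianGroup = record
        { isGroup = record
          { isMonoid = record
            { isSemigroup = record
              { isMagma = record
                { isEquivalence = record
                  { refl  = ≗⇒≈ λ _ → refl
                  ; sym   = ≈-sym
                  ; trans = ≈-trans
                  }
                ; ∙-cong = +-cong
                }
              ; assoc = λ x y z → ≗⇒≈ λ n →
                  ℚ.+-assoc (seq x n) (seq y n) (seq z n)
              }
            ; identity = (λ x → ≗⇒≈ λ n → ℚ.+-identityˡ (seq x n))
                       , (λ x → ≗⇒≈ λ n → ℚ.+-identityʳ (seq x n))
            }
          ; inverse = (λ x → ≗⇒≈ λ n → ℚ.+-inverseˡ (seq x n))
                    , (λ x → ≗⇒≈ λ n → ℚ.+-inverseʳ (seq x n))
          ; ⁻¹-cong = -‿cong
          }
        ; comm = λ x y → ≗⇒≈ λ n → ℚ.+-comm (seq x n) (seq y n)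
        }
      ; *-cong = *-cong
      ; *-assoc = λ x y z → ≗⇒≈ λ n →
          ℚ.*-assoc (seq x n) (seq y n) (seq z n)
      ; *-identity = (λ x → ≗⇒≈ λ n → ℚ.*-identityˡ (seq x n))
                   , (λ x → ≗⇒≈ λ n → ℚ.*-identityʳ (seq x n))
      ; distrib = (λ x y z → ≗⇒≈ λ n →
                    ℚ.*-distribˡ-+ (seq x n) (seq y n) (seq z n))
                , (λ x y z → ≗⇒≈ λ n →
                    ℚ.*-distribʳ-+ (seq x n) (seq y n) (seq z n))
      }
    ; *-comm = λ x y → ≗⇒≈ λ n → ℚ.*-comm (seq x n) (seq y n)
    }
  }

ℝ-rawRing : RawRing 0ℓ 0ℓ
ℝ-rawRing = CommutativeRing.rawRing ℝ-commutativeRing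

open Polynomials ℝ-rawRing public
open Matrices ℝ-rawRing public
open CharacteristicPolynomial ℝ-rawRing public

record MonicPolynomial (n : ℕ) : Set where
  field
    poly    : Poly
    isMonic : IsMonicOfDegree n poly

open MonicPolynomial public

Nonnegative : ∀ {m n} → Matrix m n → Set
Nonnegative A = ∀ i j → 0ℝ ≤ A i j

Realizable : ∀ {n} → MonicPolynomial n → Set
Realizable {n} P =
  Σ (Matrix n n) λ A → Nonnegative A × charPoly A ≈ᵖ poly P

IrreduciblyRealizable : ∀ {n} → MonicPolynomial n → Set
IrreduciblyRealizable {n} P =
  Σ (Matrix n n) λ A → Irreducible A × Nonnegative A × charPoly A ≈ᵖ poly P

infix 6 x²+_
x²+_ : ℝ → MonicPolynomial 2
x²+ k = record
  { poly    = X ^ᵖ 2 +ᵖ const k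
  ; isMonic = ≗⇒≈ (λ _ → refl) , λ
    { (suc (suc (suc zero)))    _ → ≗⇒≈ λ _ → refl
    ; (suc (suc (suc (suc _)))) _ → ≗⇒≈ λ _ → refl
    ; (suc (suc zero)) (ℕ.s≤s (ℕ.s≤s ()))
    ; (suc zero)       (ℕ.s≤s ())
    }
  }

{-# OPTIONS --safe #-}

-- The characteristic polynomial of A = (a b; c d) is x² - (a + d) x + (a d - b c).
-- If it equals x² + k₂ then a + d = 0, and as a, d ≥ 0 this gives a = 0, so
-- k₂ = - b c.  A reducible 2 × 2 matrix has b = 0 or c = 0, hence k₂ = 0.  So
-- when k₂ ≠ 0, every nonnegative matrix realizing x² + k₂ is already irreducible.

module Submission where

import Defs
open import Algebra.Bundles using (CommutativeRing; RawRing; Semiring)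
open import Algebra.Structures using (IsCommutativeRing)
import Algebra.Properties.Semiring.Sum as SemiringSum
open import Data.Bool.Base using (if_then_else_)
open import Data.Fin.Base using (Fin; zero; suc)
open import Data.Fin.Patterns using (0F; 1F)
open import Data.Fin.Permutation using (Permutation′; _⟨$⟩ʳ_)
import Data.Fin.Properties as Fin
open import Data.Nat.Base as ℕ using (ℕ; suc; z≤n; s≤s)
import Data.Nat.Properties as ℕ
open import Data.Product.Base using (_,_)
open import Data.Rational.Base as ℚ using (0ℚ; 1ℚ; ½; ∣_∣)
import Data.Rational.Properties as ℚ
open import Data.Rational.Solver using (module +-*-Solver)
open import Data.Sum.Base using (_⊎_; inj₁; inj₂)
open import Function.Base using (_∘_)
open import Function.Bundles using (_⇔_; mk⇔; Injection)
open import Function.Properties.Inverse using (↔⇒↣)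
open import Level using (0ℓ)
open import Relation.Binary.PropositionalEquality as ≡
  using (_≡_; refl; subst; subst₂)
open import Relation.Nullary.Decidable.Core using (does)
open import Relation.Nullary.Negation.Core using (¬_; contradiction)

module RingMatrices {c ℓ} (R : RawRing c ℓ)
  (isCommutativeRing : IsCommutativeRing
    (RawRing._≈_ R) (RawRing._+_ R) (RawRing._*_ R) (RawRing.-_ R)
    (RawRing.0# R) (RawRing.1# R)) where
  open RawRing R
  open IsCommutativeRing isCommutativeRing
    using (isSemiring; trans; sym; +-cong; +-identityˡ; +-identityʳ;
           *-comm; *-congˡ; *-congʳ; *-identityˡ; zeroˡ; zeroʳ;
           -‿cong; -‿inverseʳ)
  open Defs.Matrices R

  semiring : Semiring c ℓ
  semiring = record { isSemiring = isSemiring }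

  open SemiringSum semiring
    using (sum; sum-cong-≋; sum-replicate-zero)

  sum-unit-vector : ∀ {n} (i : Fin n) (f : Fin n → Carrier) →
    sum (λ k → (if does (i Fin.≟ k) then 1# else 0#) * f k) ≈ f i
  sum-unit-vector {suc n} zero f = trans
    (+-cong (*-identityˡ (f zero))
      (trans (sum-cong-≋ (λ k → zeroˡ (f (suc k)))) (sum-replicate-zero n)))
    (+-identityʳ (f zero))
  sum-unit-vector (suc i) f = trans
    (+-cong (zeroˡ (f zero)) (sum-unit-vector i (f ∘ suc)))
    (+-identityˡ (f (suc i)))

  -- Row `i` of `permutationMatrix σ` is the unit vector at `σ ⟨$⟩ʳ i`, so `sum-unit-vector`
  -- collapses each of the two matrix products to a single term.
  permutation-conjugate : ∀ {n} (σ : Permutation′ n) (A : Matrix n n) i j →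
    (permutationMatrix σ *ᴹ A *ᴹ permutationMatrix σ ᵀ) i j ≈
    A (σ ⟨$⟩ʳ i) (σ ⟨$⟩ʳ j)
  permutation-conjugate σ A i j = trans
    (sum-cong-≋ λ k → trans
      (*-congʳ (sum-unit-vector (σ ⟨$⟩ʳ i) (λ l → A l k)))
      -- The transposed factor stands on the right; commuting puts the unit vector first.
      (*-comm (A (σ ⟨$⟩ʳ i) k) (permutationMatrix σ j k)))
    (sum-unit-vector (σ ⟨$⟩ʳ j) (A (σ ⟨$⟩ʳ i)))

  -- The block size lies strictly between 0 and 2, so it is 1 and only the entry `1F 0F` of the
  -- conjugate is forced to vanish. That entry is `A (σ ⟨$⟩ʳ 1F) (σ ⟨$⟩ʳ 0F)`, which is off the
  -- diagonal because `σ` is injective.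
  reducible₂⇒zero-entry : (A : Matrix 2 2) (σ : Permutation′ 2) →
    NontriviallyBlockTriangular (permutationMatrix σ *ᴹ A *ᴹ permutationMatrix σ ᵀ) →
    A 0F 1F ≈ 0# ⊎ A 1F 0F ≈ 0#
  reducible₂⇒zero-entry A σ (suc (suc k) , _ , s≤s (s≤s ()) , _)
  reducible₂⇒zero-entry A σ (1 , _ , _ , lower-zero) =
    off-diagonal (σ ⟨$⟩ʳ 1F) (σ ⟨$⟩ʳ 0F) σ1≢σ0
      (trans (sym (permutation-conjugate σ A 1F 0F))
        (lower-zero 1F 0F (s≤s z≤n) (s≤s z≤n)))
    where
    σ1≢σ0 : ¬ (σ ⟨$⟩ʳ 1F ≡ σ ⟨$⟩ʳ 0F)
    σ1≢σ0 eq with () ← Injection.injective (↔⇒↣ σ) eq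

    off-diagonal : ∀ i j → ¬ (i ≡ j) → A i j ≈ 0# → A 0F 1F ≈ 0# ⊎ A 1F 0F ≈ 0#
    off-diagonal 0F 0F i≢j _   = contradiction refl i≢j
    off-diagonal 0F 1F _   A≈0 = inj₁ A≈0
    off-diagonal 1F 0F _   A≈0 = inj₂ A≈0
    off-diagonal 1F 1F i≢j _   = contradiction refl i≢j

  -- `Irreducible` is itself a negation, so this is a contrapositive and never decides whether an
  -- entry vanishes.
  nonzero-off-diagonal⇒irreducible : (A : Matrix 2 2) →
    ¬ (A 0F 1F ≈ 0# ⊎ A 1F 0F ≈ 0#) → Irreducible A
  nonzero-off-diagonal⇒irreducible A nonzero (σ , triangular) =
    nonzero (reducible₂⇒zero-entry A σ triangular)

  factor-zero⇒product-zero : ∀ {x y} → x ≈ 0# ⊎ y ≈ 0# → x * y ≈ 0#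
  factor-zero⇒product-zero {y = y} (inj₁ x≈0) = trans (*-congʳ x≈0) (zeroˡ y)
  factor-zero⇒product-zero {x = x} (inj₂ y≈0) = trans (*-congˡ y≈0) (zeroʳ x)

  det₂≈0 : ∀ {a b c d k} → a * d + - (b * c) ≈ k →
    a ≈ 0# → b ≈ 0# ⊎ c ≈ 0# → k ≈ 0#
  det₂≈0 det≈k a≈0 b≈0⊎c≈0 = trans (sym det≈k) (trans
    (+-cong (factor-zero⇒product-zero (inj₁ a≈0))
            (-‿cong (factor-zero⇒product-zero b≈0⊎c≈0)))
    (-‿inverseʳ 0#))

open Defs
open +-*-Solver using (Polynomial; solve; con; _:=_; _:+_; _:*_; _:-_; :-_)

module ℝ-ring = CommutativeRing ℝ-commutativeRing

open RingMatrices ℝ-rawRing ℝ-ring.isCommutativeRing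
  using (nonzero-off-diagonal⇒irreducible; det₂≈0)

-- Evaluating the polynomial and matrix operations over solver expressions
-- produces the syntax of the equations below, which hold in ℝ term by term.
expressionRing : ℕ → RawRing 0ℓ 0ℓ
expressionRing n = record
  { Carrier = Polynomial n
  ; _≈_     = _≡_
  ; _+_     = _:+_
  ; _*_     = _:*_
  ; -_      = :-_
  ; 0#      = con 0ℚ
  ; 1#      = con 1ℚ
  }

module Expressions {n : ℕ} where
  open Polynomials (expressionRing n) public
    using () renaming (coeff to :coeff; X to :X; const to :const; _+ᵖ_ to _:+ᵖ_; _^ᵖ_ to _:^ᵖ_)
  open CharacteristicPolynomial (expressionRing n) public
    using () renaming (charPoly to :charPoly)

  :matrix₂ : (a b c d : Polynomial n) → Fin 2 → Fin 2 → Polynomial n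
  :matrix₂ a b c d 0F 0F = a
  :matrix₂ a b c d 0F 1F = b
  :matrix₂ a b c d 1F 0F = c
  :matrix₂ a b c d 1F 1F = d

open Expressions

-- Conversion between two forms of a real would unfold their Cauchy proofs; here
-- it is confined to the rational terms.
≈-resp-difference : ∀ {x y u v} → x ≈ y →
  (∀ n → seq x n ℚ.- seq y n ≡ seq u n ℚ.- seq v n) → u ≈ v
≈-resp-difference x≈y same = mk≈ λ ε 0<ε →
  let N , near = close x≈y ε 0<ε in
  N , λ n l → subst (λ q → ∣ q ∣ ℚ.< ε) (same n) (near n l)

realizes-x²+⇒trace≈0 : ∀ k (A : Matrix 2 2) → charPoly A ≈ᵖ poly (x²+ k) →
  -- The coefficients of x are `- (a + d)` and 0. Their difference is that of 0 and `a + d`, so the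
  -- equation comes out reversed and `ℝ-ring.sym` turns it round.
  A 0F 0F + A 1F 1F ≈ 0ℝ
realizes-x²+⇒trace≈0 k A realizes = ℝ-ring.sym (≈-resp-difference (realizes 1) λ n →
  solve 5 (λ a b c d k →
      :coeff (:charPoly (:matrix₂ a b c d)) 1 :- :coeff (:X :^ᵖ 2 :+ᵖ :const k) 1
      := con 0ℚ :- (a :+ d)) refl
    (seq (A 0F 0F) n) (seq (A 0F 1F) n) (seq (A 1F 0F) n) (seq (A 1F 1F) n) (seq k n))

realizes-x²+⇒det≈k : ∀ k (A : Matrix 2 2) → charPoly A ≈ᵖ poly (x²+ k) →
  A 0F 0F * A 1F 1F + - (A 0F 1F * A 1F 0F) ≈ k
realizes-x²+⇒det≈k k A realizes = ≈-resp-difference (realizes 0) λ n →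
  solve 5 (λ a b c d k →
      :coeff (:charPoly (:matrix₂ a b c d)) 0 :- :coeff (:X :^ᵖ 2 :+ᵖ :const k) 0
      := (a :* d :+ :- (b :* c)) :- k) refl
    (seq (A 0F 0F) n) (seq (A 0F 1F) n) (seq (A 1F 0F) n) (seq (A 1F 1F) n) (seq k n)

-p<q∧p<q⇒∣p∣<q : ∀ {p q} → ℚ.- p ℚ.< q → p ℚ.< q → ∣ p ∣ ℚ.< q
-p<q∧p<q⇒∣p∣<q {p} {q} -p<q p<q with ℚ.∣p∣≡p∨∣p∣≡-p p
... | inj₁ ∣p∣≡p  = subst (ℚ._< q) (≡.sym ∣p∣≡p) p<q
... | inj₂ ∣p∣≡-p = subst (ℚ._< q) (≡.sym ∣p∣≡-p) -p<q

p≤∣p∣ : ∀ p → p ℚ.≤ ∣ p ∣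
p≤∣p∣ p with ℚ.≤-total 0ℚ p
... | inj₁ 0≤p = ℚ.≤-reflexive (≡.sym (ℚ.0≤p⇒∣p∣≡p 0≤p))
... | inj₂ p≤0 = ℚ.≤-trans p≤0 (ℚ.0≤∣p∣ p)

-- Nonnegativity only says that the terms are eventually above every negative rational, so each of
-- the three hypotheses is used with tolerance `½ ℚ.* ε`.
nonneg-sum-zero : ∀ {x y} → 0ℝ ≤ x → 0ℝ ≤ y → x + y ≈ 0ℝ → x ≈ 0ℝ
nonneg-sum-zero {x} {y} 0≤x 0≤y x+y≈0 = mk≈ λ ε 0<ε →
  let 0<½ε = ℚ.*-monoʳ-<-pos ½ 0<ε
      L , 0<x+½ε   = below 0≤x (½ ℚ.* ε) 0<½ε
      M , 0<y+½ε   = below 0≤y (½ ℚ.* ε) 0<½ε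
      N , ∣x+y∣<½ε = close x+y≈0 (½ ℚ.* ε) 0<½ε
  in L ℕ.⊔ (M ℕ.⊔ N) , λ n l →
  estimate (seq x n) (seq y n)
    (0<x+½ε n (ℕ.m⊔n≤o⇒m≤o L (M ℕ.⊔ N) l))
    (0<y+½ε n (ℕ.m⊔n≤o⇒m≤o M N (ℕ.m⊔n≤o⇒n≤o L (M ℕ.⊔ N) l)))
    (∣x+y∣<½ε n (ℕ.m⊔n≤o⇒n≤o M N (ℕ.m⊔n≤o⇒n≤o L (M ℕ.⊔ N) l)))
    0<½ε
  where
  estimate : ∀ p q {ε} → 0ℚ ℚ.< p ℚ.+ ½ ℚ.* ε → 0ℚ ℚ.< q ℚ.+ ½ ℚ.* ε →
    ∣ p ℚ.+ q ℚ.- 0ℚ ∣ ℚ.< ½ ℚ.* ε → 0ℚ ℚ.< ½ ℚ.* ε → ∣ p ℚ.- 0ℚ ∣ ℚ.< ε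
  estimate p q {ε} 0<p+½ε 0<q+½ε ∣p+q∣<½ε 0<½ε = -p<q∧p<q⇒∣p∣<q
    -- Lower bound: `- p` is below ε/2, hence below ε.
    (subst₂ ℚ._<_
      (solve 1 (λ p → :- (p :- con 0ℚ) :+ (con 0ℚ :+ con 0ℚ) := :- (p :- con 0ℚ)) refl p)
      (solve 2 (λ p e → :- (p :- con 0ℚ) :+ ((p :+ con ½ :* e) :+ con ½ :* e) := e) refl p ε)
      (ℚ.+-monoʳ-< (ℚ.- (p ℚ.- 0ℚ)) (ℚ.+-mono-< 0<p+½ε 0<½ε)))
    -- Upper bound: p = (p + q) - q, where p + q and - q are both below ε/2.
    (subst₂ ℚ._<_
      (solve 2 (λ p q → :- q :+ ((p :+ q :- con 0ℚ) :+ con 0ℚ) := p :- con 0ℚ) refl p q)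
      (solve 2 (λ q e → :- q :+ (con ½ :* e :+ (q :+ con ½ :* e)) := e) refl q ε)
      (ℚ.+-monoʳ-< (ℚ.- q)
        (ℚ.+-mono-< (ℚ.≤-<-trans (p≤∣p∣ (p ℚ.+ q ℚ.- 0ℚ)) ∣p+q∣<½ε) 0<q+½ε)))

realizes-x²+∧zero-entry⇒k≈0 : ∀ k (A : Matrix 2 2) → Nonnegative A →
  charPoly A ≈ᵖ poly (x²+ k) → A 0F 1F ≈ 0ℝ ⊎ A 1F 0F ≈ 0ℝ → k ≈ 0ℝ
realizes-x²+∧zero-entry⇒k≈0 k A A≥0 realizes = det₂≈0
  {A 0F 0F} {A 0F 1F} {A 1F 0F} {A 1F 1F} {k}
  -- Both sides are the same equation in different forms; only their rational terms are compared.
  (≈-resp-difference (realizes-x²+⇒det≈k k A realizes) λ _ → refl)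
  (nonneg-sum-zero (A≥0 0F 0F) (A≥0 1F 1F) (realizes-x²+⇒trace≈0 k A realizes))

corollary23 : (k₂ : ℝ) → ¬ (k₂ ≈ 0ℝ) → Realizable (x²+ k₂) ⇔ IrreduciblyRealizable (x²+ k₂)
corollary23 k₂ k₂≉0 = mk⇔
  (λ (A , A≥0 , realizes) →
    A
    , nonzero-off-diagonal⇒irreducible A (k₂≉0 ∘ realizes-x²+∧zero-entry⇒k≈0 k₂ A A≥0 realizes)
    , A≥0 , realizes)
  (λ (A , _ , A≥0 , realizes) → A , A≥0 , realizes)
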